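{- Every FMP instance $\mathscr{F}=(G,B,\{\mathscr{T}_g\}_{g\in G})$ has an equivalent FMP instance $\mathscr{F}'=(G',B',\{\mathscr{T}_g\}_{g\in G'})$ (equivalent meaning: $\mathscr{F}$ has a solution if and only if $\mathscr{F}'$ has a solution) in which every tradeoff set contains at most three tradeoffs. Moreover, $\mathscr{F}'$ can be chosen so that every tradeoff set contains at most one fractional tradeoff, and every tradeoff set containing a fractional tradeoff consists of exactly two tradeoffs. The instance $\mathscr{F}'$ can be computed from $\mathscr{F}$ in polynomial time.
   Context: An FMP instance is a triple $(G,B,\{\mathscr{T}_g\}_{g\in G})$ with $G,B$ finite sets and, for each $g\in G$, $\mathscr{T}_g$ a finite set of tradeoffs; a tradeoff is a finite collection $\{p_1b_1,\dots,p_kb_k\}$ of fragments $p_jb_j$ with $b_j\in B$, rational $0\le p_j\le1$, $\sum_jp_j=1$. A solution is a choice of one tradeoff $t_g\in\mathscr{T}_g$ for each $g$ such that for each $b\in B$ the total coefficient of $b$ over all chosen $t_g$ is at most $1$. A tradeoff is integral if it consists of a single element with coefficient $1$ (i.e. $\{b\}$), and fractional otherwise. -}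

module Defs where

open import Data.Fin.Base using (Fin; zero; toℕ)
open import Data.Fin.Properties using (_≟_)
open import Data.Integer.Base using (ℤ; +_; -[1+_])
open import Data.List.Base using (List; []; _∷_; foldr; map; filter; length; replicate; tabulate)
open import Data.List.Membership.Propositional using (_∈_)
open import Data.List.Relation.Binary.Permutation.Propositional using (_↭_)
open import Data.List.Relation.Unary.All using (All)
open import Data.List.Relation.Unary.AllPairs using (AllPairs)
open import Data.Nat.Base as ℕ using (ℕ; zero; suc)
open import Data.Nat.Binary.Base using (ℕᵇ; zero; 2[1+_]; 1+[2_]; fromℕ)
open import Data.Product.Base using (Σ-syntax; ∃-syntax; _×_; _,_; proj₁; proj₂)
open import Data.Rational.Base using (ℚ; 0ℚ; 1ℚ; _+_; _≤_; ↥_; ↧ₙ_)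
open import Data.Rational.Properties using (+-0-commutativeMonoid)
open import Data.Vec.Base as Vec using (Vec; lookup; _[_]≔_)
open import Relation.Binary.PropositionalEquality.Core using (_≡_; _≢_)
open import Relation.Nullary.Negation.Core using (¬_)

import Algebra.Properties.CommutativeMonoid.Sum as Sum
open Sum +-0-commutativeMonoid using (sum)

------------------------------------------------------------------------
-- FMP instances

sumℚ : List ℚ → ℚ
sumℚ = foldr _+_ 0ℚ

Fragment : ℕ → Set
Fragment n = ℚ × Fin n

record Tradeoff (n : ℕ) : Set where
  field
    fragments : List (Fragment n)
    bounded   : All (λ (p , _) → 0ℚ ≤ p × p ≤ 1ℚ) fragments
    total     : sumℚ (map proj₁ fragments) ≡ 1ℚ

open Tradeoff public

-- A tradeoff is an unordered collection, so the order in which its fragments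
-- are listed is irrelevant.
infix 4 _≈_

_≈_ : ∀ {n} → Tradeoff n → Tradeoff n → Set
t ≈ u = fragments t ↭ fragments u

Integral : ∀ {n} → Tradeoff n → Set
Integral t = ∃[ b ] fragments t ≡ (1ℚ , b) ∷ []

Fractional : ∀ {n} → Tradeoff n → Set
Fractional t = ¬ Integral t

-- Since the entries of a tradeoff set are pairwise distinct, the length of the
-- list is the cardinality of the set.
record FMP : Set where
  field
    ∣G∣       : ℕ
    ∣B∣       : ℕ
    tradeoffs : Fin ∣G∣ → List (Tradeoff ∣B∣)
    distinct  : ∀ g → AllPairs (λ t u → ¬ (t ≈ u)) (tradeoffs g)

open FMP public

coefficient : ∀ {n} → Fin n → Tradeoff n → ℚ
coefficient b t = sumℚ (map proj₁ (filter (λ (_ , c) → c ≟ b) (fragments t)))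

record Solution (F : FMP) : Set where
  field
    choice   : Fin (∣G∣ F) → Tradeoff (∣B∣ F)
    allowed  : ∀ g → choice g ∈ tradeoffs F g
    feasible : ∀ b → sum (λ g → coefficient b (choice g)) ≤ 1ℚ

AtMostThreeTradeoffs : FMP → Set
AtMostThreeTradeoffs F = ∀ g → length (tradeoffs F g) ℕ.≤ 3

AtMostOneFractional : FMP → Set
AtMostOneFractional F = ∀ g {t u} →
  t ∈ tradeoffs F g → u ∈ tradeoffs F g →
  Fractional t → Fractional u → t ≈ u

FractionalInPairs : FMP → Set
FractionalInPairs F = ∀ g {t} →
  t ∈ tradeoffs F g → Fractional t → length (tradeoffs F g) ≡ 2

------------------------------------------------------------------------
-- Polynomial-time computation
--
-- The machine model is Jones' WHILE language over binary trees ("Computability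
-- and Complexity from a Programming Perspective", 1997), with finitely many
-- registers.  Reading a register costs the size of the tree it holds, so a run
-- of cost t can neither hide the copying of large data in one step nor build a
-- tree of size above t, and the model is polynomially equivalent to Turing
-- machines, also for computing functions.

infixr 5 _∙_

data Tree : Set where
  nil : Tree
  _∙_ : Tree → Tree → Tree

size : Tree → ℕ
size nil     = 1
size (l ∙ r) = suc (size l ℕ.+ size r)

left right : Tree → Tree
left  nil     = nil
left  (l ∙ _) = l
right nil     = nil
right (_ ∙ r) = r

data Expr (k : ℕ) : Set where
  reg   : Fin k → Expr k
  nil   : Expr k
  _∙_   : Expr k → Expr k → Expr k
  hd tl : Expr k → Expr k

Store : ℕ → Set
Store k = Vec Tree k

eval : ∀ {k} → Expr k → Store k → Tree
eval (reg x) σ = lookup σ x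
eval nil     σ = nil
eval (e ∙ f) σ = eval e σ ∙ eval f σ
eval (hd e)  σ = left (eval e σ)
eval (tl e)  σ = right (eval e σ)

cost : ∀ {k} → Expr k → Store k → ℕ
cost (reg x) σ = size (lookup σ x)
cost nil     σ = 1
cost (e ∙ f) σ = suc (cost e σ ℕ.+ cost f σ)
cost (hd e)  σ = suc (cost e σ)
cost (tl e)  σ = suc (cost e σ)

infix  6 _≔_
infixr 5 _⨾_

data Command (k : ℕ) : Set where
  _≔_       : Fin k → Expr k → Command k
  _⨾_       : Command k → Command k → Command k
  while_⟨_⟩ : Expr k → Command k → Command k

-- c , σ ⇓[ t ] τ: started in store σ, the command c halts in store τ after
-- running for time t.  The guard of a loop is true when it is not nil.
infix 4 _,_⇓[_]_

data _,_⇓[_]_ {k : ℕ} : Command k → Store k → ℕ → Store k → Set where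
  assign : ∀ {x e σ} →
    x ≔ e , σ ⇓[ suc (cost e σ) ] (σ [ x ]≔ eval e σ)
  seq : ∀ {c d σ τ υ s t} →
    c , σ ⇓[ s ] τ → d , τ ⇓[ t ] υ →
    c ⨾ d , σ ⇓[ s ℕ.+ t ] υ
  stop : ∀ {e c σ} →
    eval e σ ≡ nil →
    while e ⟨ c ⟩ , σ ⇓[ suc (cost e σ) ] σ
  loop : ∀ {e c σ τ υ s t} →
    eval e σ ≢ nil → c , σ ⇓[ s ] τ → while e ⟨ c ⟩ , τ ⇓[ t ] υ →
    while e ⟨ c ⟩ , σ ⇓[ suc (cost e σ) ℕ.+ s ℕ.+ t ] υ

-- Input and output are held in register 0; the other registers start as nil.
record Program : Set where
  field
    spare : ℕ
    body  : Command (suc spare)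

infix 4 _computes_↦_within_

_computes_↦_within_ : Program → Tree → Tree → ℕ → Set
P computes x ↦ y within b =
  ∃[ t ] ∃[ σ ] (body , (x Vec.∷ Vec.replicate spare nil) ⇓[ t ] σ)
              × Vec.head σ ≡ y × t ℕ.≤ b
  where open Program P

PolyTime : ∀ {A B : Set} → (A → Tree) → (B → Tree) → (A → B) → Set
PolyTime {A} encA encB f =
  Σ[ P ∈ Program ] ∃[ c ] ∃[ d ] ((x : A) →
    P computes encA x ↦ encB (f x) within c ℕ.* size (encA x) ℕ.^ d)

------------------------------------------------------------------------
-- Encoding of instances
--
-- Numerators and denominators are written in binary.  The elements of B are
-- numbered in unary, and B itself is given as a list of length ∣B∣; as an
-- instance lists the elements of B explicitly, this agrees with binary
-- numbering up to a polynomial in the size of the instance.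

encodeList : ∀ {A : Set} → (A → Tree) → List A → Tree
encodeList enc = foldr (λ a r → enc a ∙ r) nil

encodeUnary : ℕ → Tree
encodeUnary n = encodeList (λ t → t) (replicate n nil)

encodeBinary : ℕᵇ → Tree
encodeBinary zero     = nil
encodeBinary 2[1+ n ] = nil ∙ encodeBinary n
encodeBinary 1+[2 n ] = (nil ∙ nil) ∙ encodeBinary n

encodeℤ : ℤ → Tree
encodeℤ (+ n)    = nil ∙ encodeBinary (fromℕ n)
encodeℤ -[1+ n ] = (nil ∙ nil) ∙ encodeBinary (fromℕ n)

encodeℚ : ℚ → Tree
encodeℚ p = encodeℤ (↥ p) ∙ encodeBinary (fromℕ (↧ₙ p))

encodeFragment : ∀ {n} → Fragment n → Tree
encodeFragment (p , b) = encodeℚ p ∙ encodeUnary (toℕ b)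

encodeTradeoff : ∀ {n} → Tradeoff n → Tree
encodeTradeoff t = encodeList encodeFragment (fragments t)

encodeFMP : FMP → Tree
encodeFMP F =
  encodeUnary (∣B∣ F) ∙ encodeList (encodeList encodeTradeoff) (tabulate (tradeoffs F))

{-# OPTIONS --safe #-}
module Submission where

-- Give a set {t₁, …, tₖ} fresh elements c₀, b₁, c₁, …, bₖ, cₖ and replace it by the sets {c₀}, {cₖ} and, for every i,
-- {cᵢ₋₁, bᵢ, cᵢ} and {bᵢ, tᵢ}.  The first set occupies c₀; an occupied cᵢ₋₁ forces the i-th triple to take bᵢ, and
-- then tᵢ is chosen, or to occupy cᵢ.  As the last set needs cₖ, some tᵢ is chosen.  Conversely, when tᵢ is chosen,
-- the triples before it take their third and those after it their first element.
--
-- Fresh elements are numbered from ∣B∣ on, so the fragments of tᵢ are copied unchanged and the program only needs a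
-- unary counter.  The counter stays linear and the output quadratic in the size of the input, so the linearly many
-- steps take cubic time.

open import Defs
open import Data.Product.Base using (Σ-syntax; _×_)
open import Function.Bundles using (_⇔_)

open import Data.Fin.Base using (Fin; zero; suc; toℕ; fromℕ<)
open import Data.Fin.Patterns using (0F; 1F; 2F; 3F)
open import Data.Fin.Properties using (toℕ-fromℕ<; toℕ<n; toℕ-injective) renaming (_≟_ to _≟ᶠ_)
open import Data.List.Base using (List; []; _∷_; [_]; map; filter; length; lookup; tabulate)
open import Data.List.Membership.Propositional using (_∈_)
open import Data.List.Membership.Propositional.Properties using (∈-map⁺; ∈-map⁻; ∈-lookup)
open import Data.List.Properties
  using (filter-accept; filter-reject; filter-none; map-tabulate; tabulate-cong; tabulate-lookup)
open import Data.List.Relation.Binary.Permutation.Propositional using (↭-refl; ↭-sym)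
open import Data.List.Relation.Binary.Permutation.Propositional.Properties as ↭ using (↭-singleton-inv)
open import Data.List.Relation.Binary.Pointwise as Pointwise using (Pointwise; []; _∷_)
open import Data.List.Relation.Unary.All as All using (All; []; _∷_)
import Data.List.Relation.Unary.All.Properties as All
open import Data.List.Relation.Unary.AllPairs using (AllPairs; []; _∷_)
open import Data.List.Relation.Unary.Any using (here; there)
open import Data.Nat.Base as ℕ using (ℕ; zero; suc; z≤n; s≤s)
import Data.Nat.Properties as ℕ
open import Data.Nat.Tactic.RingSolver using (solve-∀)
open import Data.Product.Base using (∃-syntax; _,_; proj₁; proj₂; map₂)
open import Data.Rational.Base using (ℚ; 0ℚ; 1ℚ)
open import Data.Rational.Properties using (+-0-commutativeMonoid)
open import Data.Sum.Base using (_⊎_; inj₁; inj₂)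
open import Data.Vec.Base using ([]; _∷_; _[_]≔_)
open import Data.Vec.Relation.Unary.All as VecAll using ([]; _∷_)
import Data.Vec.Relation.Unary.All.Properties as VecAll
open import Function.Base using (_∘_)
open import Function.Bundles using (mk⇔)
open import Relation.Binary.PropositionalEquality
  using (_≡_; _≢_; refl; sym; trans; cong; cong₂; subst; subst₂; module ≡-Reasoning)
open import Relation.Nullary.Decidable using (yes; no; from-yes; from-no)
open import Relation.Nullary.Negation using (¬_; contradiction)

import Algebra.Properties.CommutativeMonoid.Sum as Sum
open Sum +-0-commutativeMonoid using (sum)

module Correctness where

  open import Data.Rational.Base using (_+_; _≤_)
  open import Data.Rational.Properties
    using (+-identityˡ; +-identityʳ; +-assoc; +-comm; +-mono-≤; +-monoʳ-≤; +-monoˡ-≤;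
           ≤-refl; ≤-reflexive; ≤-trans; _≤?_; module ≤-Reasoning)

  -- Tradeoffs over natural numbers

  -- Elements are plain numbers, so tradeoffs need no reindexing when fresh elements are added, and
  -- their encodings stay literally the same.
  Raw : Set
  Raw = List (ℚ × ℕ)

  single : ℕ → Raw
  single a = [ (1ℚ , a) ]

  coef : ℕ → Raw → ℚ
  coef b t = sumℚ (map proj₁ (filter (λ (_ , c) → c ℕ.≟ b) t))

  load : ℕ → List Raw → ℚ
  load b ts = sumℚ (map (coef b) ts)

  NonNeg : Raw → Set
  NonNeg = All (λ (p , _) → 0ℚ ≤ p)

  InRange : ℕ → Raw → Set
  InRange n = All (λ (_ , c) → c ℕ.< n)

  record Valid (n : ℕ) (t : Raw) : Set where
    constructor valid
    field
      inRange : InRange n t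
      weights : All (λ (p , _) → 0ℚ ≤ p × p ≤ 1ℚ) t
      sums    : sumℚ (map proj₁ t) ≡ 1ℚ

  open Valid

  RawSolution : List (List Raw) → Set
  RawSolution S = ∃[ ts ] Pointwise _∈_ ts S × (∀ b → load b ts ≤ 1ℚ)

  0≤1 : 0ℚ ≤ 1ℚ
  0≤1 = from-yes (0ℚ ≤? 1ℚ)

  ≤-addˡ : ∀ {x y} → 0ℚ ≤ x → y ≤ x + y
  ≤-addˡ {x} {y} 0≤x = subst (_≤ x + y) (+-identityˡ y) (+-monoˡ-≤ y 0≤x)

  0≤sumℚ : ∀ {xs} → All (0ℚ ≤_) xs → 0ℚ ≤ sumℚ xs
  0≤sumℚ []       = ≤-refl
  0≤sumℚ (p ∷ ps) = +-mono-≤ p (0≤sumℚ ps)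

  coef-nonneg : ∀ b {t} → NonNeg t → 0ℚ ≤ coef b t
  coef-nonneg b p = 0≤sumℚ (All.map⁺ (All.filter⁺ (λ (_ , c) → c ℕ.≟ b) p))

  load-nonneg : ∀ b {ts} → All NonNeg ts → 0ℚ ≤ load b ts
  load-nonneg b p = 0≤sumℚ (All.map⁺ (All.map (coef-nonneg b) p))

  coef-absent : ∀ {b t} → All (λ (_ , c) → c ≢ b) t → coef b t ≡ 0ℚ
  coef-absent {b} p = cong (sumℚ ∘ map proj₁) (filter-none (λ (_ , c) → c ℕ.≟ b) p)

  coef-single : ∀ a → coef a (single a) ≡ 1ℚ
  coef-single a = cong (sumℚ ∘ map proj₁) (filter-accept (λ (_ , c) → c ℕ.≟ a) {xs = []} refl)

  coef-outside : ∀ {n b t} → Valid n t → n ℕ.≤ b → coef b t ≡ 0ℚ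
  coef-outside v n≤b = coef-absent (All.map (λ { c<n refl → ℕ.<⇒≱ c<n n≤b }) (inRange v))

  -- The sets that replace an instance

  -- The cᵢ are n, n + 2, n + 4, … and the bᵢ are n + 1, n + 3, … .  Sets are
  -- pushed onto an accumulator because that is the order in which the program emits them.
  chain : ℕ → List Raw → List (List Raw) → List (List Raw)
  chain n []       S = S
  chain n (t ∷ ts) S = chain (2 ℕ.+ n) ts
    ((single (1 ℕ.+ n) ∷ t ∷ []) ∷ (single n ∷ single (1 ℕ.+ n) ∷ single (2 ℕ.+ n) ∷ []) ∷ S)

  chainEnd : ℕ → List Raw → ℕ
  chainEnd n []       = n
  chainEnd n (_ ∷ ts) = chainEnd (2 ℕ.+ n) ts

  gadgets : ℕ → List (List Raw) → List (List Raw) → List (List Raw)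
  gadgets n []       S = S
  gadgets n (ts ∷ G) S =
    gadgets (suc (chainEnd n ts)) G ([ single (chainEnd n ts) ] ∷ chain n ts ([ single n ] ∷ S))

  gadgetsEnd : ℕ → List (List Raw) → ℕ
  gadgetsEnd n []       = n
  gadgetsEnd n (ts ∷ G) = gadgetsEnd (suc (chainEnd n ts)) G

  -- From a solution of the instance to one of the gadgets

  module _ (B : ℕ) where

    -- The invariant while gadgets are emitted: `ts` are the original tradeoffs selected so far,
    -- `us` the choices made in the emitted sets, and `n` is the first element that is certainly
    -- untouched.
    record Extends (n : ℕ) (ts us : List Raw) : Set where
      constructor extends
      field
        B≤n   : B ℕ.≤ n
        below : ∀ {b} → b ℕ.< B → load b us ≡ load b ts
        used  : ∀ {b} → B ℕ.≤ b → load b us ≤ 1ℚ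
        fresh : ∀ {b} → n ℕ.≤ b → load b us ≡ 0ℚ

    open Extends

    extend-single : ∀ {n ts us} → Extends n ts us → Extends (suc n) ts (single n ∷ us)
    extend-single {n} {ts} {us} e = extends (ℕ.m≤n⇒m≤1+n (B≤n e)) below′ used′ fresh′
      where
      other : ∀ {b} → n ≢ b → load b (single n ∷ us) ≡ load b us
      other n≢b = trans (cong (_+ _) (coef-absent (n≢b ∷ []))) (+-identityˡ _)

      below′ : ∀ {b} → b ℕ.< B → load b (single n ∷ us) ≡ load b ts
      below′ b<B = trans (other (λ { refl → ℕ.<⇒≱ b<B (B≤n e) })) (below e b<B)

      used′ : ∀ {b} → B ℕ.≤ b → load b (single n ∷ us) ≤ 1ℚ
      used′ {b} B≤b with n ℕ.≟ b
      ... | yes refl = ≤-reflexive (cong₂ _+_ (coef-single n) (fresh e ℕ.≤-refl))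
      ... | no  n≢b  = subst (_≤ 1ℚ) (sym (other n≢b)) (used e B≤b)

      fresh′ : ∀ {b} → suc n ℕ.≤ b → load b (single n ∷ us) ≡ 0ℚ
      fresh′ n<b = trans (other (ℕ.<⇒≢ n<b)) (fresh e (ℕ.<⇒≤ n<b))

    extend-tradeoff : ∀ {n t ts us} → Valid B t → Extends n ts us → Extends n (t ∷ ts) (t ∷ us)
    extend-tradeoff {n} {t} {ts} {us} v e =
      extends (B≤n e) (λ {b} b<B → cong (coef b t +_) (below e b<B))
        (λ B≤b → subst (_≤ 1ℚ) (sym (same B≤b)) (used e B≤b))
        (λ n≤b → trans (same (ℕ.≤-trans (B≤n e) n≤b)) (fresh e n≤b))
      where
      same : ∀ {b} → B ℕ.≤ b → load b (t ∷ us) ≡ load b us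
      same B≤b = trans (cong (_+ _) (coef-outside v B≤b)) (+-identityˡ _)

    -- When a triple takes its third element, its pair takes the smaller middle one. The two are
    -- then occupied in the opposite order to the one in which their sets are emitted.
    extend-swap : ∀ {n ts us} t u → Extends n ts (t ∷ u ∷ us) → Extends n ts (u ∷ t ∷ us)
    extend-swap {us = us} t u e =
      extends (B≤n e) (λ {b} p → trans (swap b) (below e p))
        (λ {b} p → subst (_≤ 1ℚ) (sym (swap b)) (used e p))
        (λ {b} p → trans (swap b) (fresh e p))
      where
      swap : ∀ b → load b (u ∷ t ∷ us) ≡ load b (t ∷ u ∷ us)
      swap b = begin
        coef b u + (coef b t + load b us) ≡⟨ +-assoc (coef b u) (coef b t) _ ⟨
        coef b u + coef b t + load b us   ≡⟨ cong (_+ load b us) (+-comm (coef b u) (coef b t)) ⟩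
        coef b t + coef b u + load b us   ≡⟨ +-assoc (coef b t) (coef b u) _ ⟩
        coef b t + (coef b u + load b us) ∎
        where open ≡-Reasoning

    -- Once the current link `n` is free, every triple takes its first element and every pair its
    -- fresh one, so that the next link is free again, and so is the end of the chain.
    chain-free : ∀ {n S ts us} vs → Pointwise _∈_ us S → Extends n ts us →
      ∃[ ws ] Pointwise _∈_ ws (chain n vs S) × Extends (chainEnd n vs) ts ws
    chain-free         []       p e = _ , p , e
    chain-free {n = n} (v ∷ vs) p e =
      chain-free vs (here refl ∷ here refl ∷ p) (extend-single (extend-single e))

    -- Here `n` may be occupied. Triples pass the occupation on to the next link until `t` is
    -- reached; there the triple takes its middle element, the pair takes `t`, and `chain-free`
    -- finishes.
    chain-blocked : ∀ {n S t ts us} vs → t ∈ vs → Valid B t → Pointwise _∈_ us S → Extends (suc n) ts us →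
      ∃[ ws ] Pointwise _∈_ ws (chain n vs S) × Extends (chainEnd n vs) (t ∷ ts) ws
    chain-blocked (v ∷ vs) (here refl) ok p e =
      chain-free vs (there (here refl) ∷ there (here refl) ∷ p)
        (extend-tradeoff ok (extend-single e))
    chain-blocked {n = n} (v ∷ vs) (there t∈vs) ok p e =
      chain-blocked vs t∈vs ok (here refl ∷ there (there (here refl)) ∷ p)
        (extend-swap (single (2 ℕ.+ n)) (single (1 ℕ.+ n)) (extend-single (extend-single e)))

    -- The opening peg occupies `n`, and the closing peg takes the link left free by
    -- `chain-blocked`. As `ts′` collects the selected tradeoffs in reverse, it is compared with
    -- `vs` through loads only.
    gadgets-extend : ∀ {n S ts us} G {vs} → All (All (Valid B)) G →
      Pointwise _∈_ vs G → Pointwise _∈_ us S → Extends n ts us →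
      ∃[ ts′ ] ∃[ ws ] (∀ b → load b ts′ ≡ load b vs + load b ts)
        × Pointwise _∈_ ws (gadgets n G S) × Extends (gadgetsEnd n G) ts′ ws
    gadgets-extend [] [] [] p e = _ , _ , (λ b → sym (+-identityˡ _)) , p , e
    gadgets-extend {n = n} {ts = ts} (g ∷ G) {v ∷ vs} (ok ∷ oks) (v∈g ∷ q) p e
      with us′ , p′ , e′ ← chain-blocked {n = n} g v∈g (All.lookup ok v∈g) (here refl ∷ p) (extend-single e)
      with ts′ , ws , eq , p″ , e″ ← gadgets-extend G oks q (here refl ∷ p′) (extend-single e′)
      = ts′ , ws , (λ b → trans (eq b) (shuffle b)) , p″ , e″
      where
      shuffle : ∀ b → load b vs + (coef b v + load b ts) ≡ coef b v + load b vs + load b ts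
      shuffle b = trans (sym (+-assoc (load b vs) (coef b v) _))
                        (cong (_+ load b ts) (+-comm (load b vs) (coef b v)))

  load-outside : ∀ {B b ts} → All (Valid B) ts → B ℕ.≤ b → load b ts ≡ 0ℚ
  load-outside []       B≤b = refl
  load-outside (v ∷ vs) B≤b = cong₂ _+_ (coef-outside v B≤b) (load-outside vs B≤b)

  choice-All : ∀ {P : Raw → Set} {S ts} → All (All P) S → Pointwise _∈_ ts S → All P ts
  choice-All []       []       = []
  choice-All (p ∷ ps) (q ∷ qs) = All.lookup p q ∷ choice-All ps qs

  gadgets-complete : ∀ B G → All (All (Valid B)) G → RawSolution G → RawSolution (gadgets B G [])
  gadgets-complete B G ok (vs , p , ≤1)
    with ts , ws , eq , q , e ← gadgets-extend B {n = B} {ts = []} G ok p []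
           (extends ℕ.≤-refl (λ _ → refl) (λ _ → 0≤1) (λ _ → refl))
    = ws , q , bound
    where
    open Extends
    bound : ∀ b → load b ws ≤ 1ℚ
    bound b with b ℕ.<? B
    ... | yes b<B = subst (_≤ 1ℚ) (sym (trans (below e b<B) (trans (eq b) (+-identityʳ _)))) (≤1 b)
    ... | no  b≮B = used e (ℕ.≮⇒≥ b≮B)

  -- From a solution of the gadgets back to one of the instance

  2≰1 : ¬ 1ℚ + 1ℚ ≤ 1ℚ
  2≰1 = from-no (1ℚ + 1ℚ ≤? 1ℚ)

  coef-single≥1 : ∀ a → 1ℚ ≤ coef a (single a)
  coef-single≥1 a = ≤-reflexive (sym (coef-single a))

  load-single≥1 : ∀ a {us} → All NonNeg us → 1ℚ ≤ load a (single a ∷ us)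
  load-single≥1 a nn = +-mono-≤ (coef-single≥1 a) (load-nonneg a nn)

  overfull : ∀ {x y z} → 1ℚ ≤ x → 1ℚ ≤ y → x + y ≤ z → ¬ z ≤ 1ℚ
  overfull p q r s = 2≰1 (≤-trans (+-mono-≤ p q) (≤-trans r s))

  -- Suppose `vs` fills `n`. The first triple cannot take `n`. If it takes `1 + n`, the pair cannot,
  -- so it selects its tradeoff; if it takes `2 + n`, that link is filled and induction applies. The
  -- last alternative is that the end of the chain gets filled.
  chain⁻ : ∀ n ts {S us} → Pointwise _∈_ us (chain n ts S) → All NonNeg us → (∀ b → load b us ≤ 1ℚ) →
    ∃[ vs ] Pointwise _∈_ vs S × All NonNeg vs × (∀ b → load b vs ≤ load b us)
      × (1ℚ ≤ load n vs →
          (∃[ t ] t ∈ ts × ∀ b → coef b t + load b vs ≤ load b us) ⊎ 1ℚ ≤ load (chainEnd n ts) us)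
  chain⁻ n []       p nn ≤1 = _ , p , nn , (λ _ → ≤-refl) , inj₂
  chain⁻ n (t ∷ ts) {us = us} p nn ≤1
    -- The accumulator puts later sets in front, so the rest of the chain is peeled off first, which
    -- exposes the choices `x` from the pair and `y` from the triple.
    with x ∷ y ∷ vs , x∈ ∷ y∈ ∷ q , nx ∷ ny ∷ nvs , vs≤us , cont ← chain⁻ (2 ℕ.+ n) ts p nn ≤1
    = vs , q , nvs , (λ b → ≤-trans (drop₂ b) (vs≤us b)) , blocked x∈ y∈
    where
    drop₁ : ∀ b → load b vs ≤ coef b y + load b vs
    drop₁ b = ≤-addˡ (coef-nonneg b ny)

    drop₂ : ∀ b → load b vs ≤ coef b x + (coef b y + load b vs)
    drop₂ b = ≤-trans (drop₁ b) (≤-addˡ (coef-nonneg b nx))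

    blocked : x ∈ single (1 ℕ.+ n) ∷ t ∷ [] → y ∈ single n ∷ single (1 ℕ.+ n) ∷ single (2 ℕ.+ n) ∷ [] →
      1ℚ ≤ load n vs →
      (∃[ u ] u ∈ t ∷ ts × ∀ b → coef b u + load b vs ≤ load b us) ⊎ 1ℚ ≤ load (chainEnd n (t ∷ ts)) us
    blocked _ (here refl) 1≤ = contradiction (≤1 n)
      (overfull (coef-single≥1 n) 1≤ (≤-trans (≤-addˡ (coef-nonneg n nx)) (vs≤us n)))
    blocked (here refl) (there (here refl)) 1≤ = contradiction (≤1 (1 ℕ.+ n))
      (overfull (coef-single≥1 (1 ℕ.+ n)) (load-single≥1 (1 ℕ.+ n) nvs) (vs≤us (1 ℕ.+ n)))
    blocked (there (here refl)) (there (here refl)) 1≤ =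
      inj₁ (t , here refl , λ b → ≤-trans (+-monoʳ-≤ (coef b t) (drop₁ b)) (vs≤us b))
    blocked _ (there (there (here refl))) 1≤
      with cont (≤-trans (load-single≥1 (2 ℕ.+ n) nvs) (≤-addˡ (coef-nonneg (2 ℕ.+ n) nx)))
    ... | inj₁ (u , u∈ , le) = inj₁ (u , there u∈ , λ b → ≤-trans (+-monoʳ-≤ (coef b u) (drop₂ b)) (le b))
    ... | inj₂ full          = inj₂ full

  -- The opening peg starts the propagation in `chain⁻`, and the closing peg forbids it to reach the
  -- end, so some tradeoff of each set is selected. The bound on `vs` alone is carried separately
  -- because nonnegativity is tracked for `vs` but not for `ws`.
  gadgets⁻ : ∀ n G {S us} → Pointwise _∈_ us (gadgets n G S) → All NonNeg us → (∀ b → load b us ≤ 1ℚ) →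
    ∃[ vs ] ∃[ ws ] Pointwise _∈_ vs S × Pointwise _∈_ ws G × All NonNeg vs
      × (∀ b → load b vs ≤ load b us) × (∀ b → load b ws + load b vs ≤ load b us)
  gadgets⁻ n []       p nn ≤1 = _ , [] , p , [] , nn , (λ _ → ≤-refl) , (λ _ → ≤-reflexive (+-identityˡ _))
  gadgets⁻ n (ts ∷ G) {S} {us} p nn ≤1
    with x ∷ us₁ , ws , here refl ∷ q , r , nx ∷ nus₁ , le₁ , le ← gadgets⁻ (suc (chainEnd n ts)) G p nn ≤1
    with y ∷ vs , here refl ∷ s , ny ∷ nvs , le₂ , found ← chain⁻ n ts q nus₁
           (λ b → ≤-trans (≤-addˡ (coef-nonneg b nx)) (≤-trans (le₁ b) (≤1 b)))
    = vs , result (found (load-single≥1 n nvs))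
    where
    e = chainEnd n ts

    dropx : ∀ b → load b us₁ ≤ load b us
    dropx b = ≤-trans (≤-addˡ (coef-nonneg b nx)) (le₁ b)

    dropy : ∀ b → load b vs ≤ load b (single n ∷ vs)
    dropy b = ≤-addˡ (coef-nonneg b ny)

    total≤ : ∀ t → (∀ b → coef b t + load b (single n ∷ vs) ≤ load b us₁) →
      ∀ b → coef b t + load b ws + load b vs ≤ load b us
    total≤ t t≤ b = begin
      coef b t + load b ws + load b vs     ≡⟨ cong (_+ load b vs) (+-comm (coef b t) (load b ws)) ⟩
      load b ws + coef b t + load b vs     ≡⟨ +-assoc (load b ws) (coef b t) (load b vs) ⟩
      load b ws + (coef b t + load b vs)   ≤⟨ +-monoʳ-≤ (load b ws) (+-monoʳ-≤ (coef b t) (dropy b)) ⟩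
      load b ws + (coef b t + load b (single n ∷ vs)) ≤⟨ +-monoʳ-≤ (load b ws) (t≤ b) ⟩
      load b ws + load b us₁               ≤⟨ +-monoʳ-≤ (load b ws) (≤-addˡ (coef-nonneg b nx)) ⟩
      load b ws + load b (single e ∷ us₁)  ≤⟨ le b ⟩
      load b us                            ∎
      where open ≤-Reasoning

    result : (∃[ t ] t ∈ ts × ∀ b → coef b t + load b (single n ∷ vs) ≤ load b us₁) ⊎ 1ℚ ≤ load e us₁ →
      ∃[ ws′ ] Pointwise _∈_ vs S × Pointwise _∈_ ws′ (ts ∷ G) × All NonNeg vs
        × (∀ b → load b vs ≤ load b us) × (∀ b → load b ws′ + load b vs ≤ load b us)
    result (inj₁ (t , t∈ts , t≤)) =
      t ∷ ws , s , t∈ts ∷ r , nvs , (λ b → ≤-trans (dropy b) (≤-trans (le₂ b) (dropx b))) , total≤ t t≤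
    -- The end of the chain would be filled both by the propagation and by the closing peg.
    result (inj₂ full) = contradiction (≤1 e) (overfull (coef-single≥1 e) full (le₁ e))

  gadgets-sound : ∀ n G → All (All NonNeg) (gadgets n G []) → RawSolution (gadgets n G []) → RawSolution G
  gadgets-sound n G nn (us , p , ≤1)
    with _ , ws , [] , q , _ , _ , le ← gadgets⁻ n G p (choice-All nn p) ≤1
    = ws , q , λ b → ≤-trans (≤-reflexive (sym (+-identityʳ _))) (≤-trans (le b) (≤1 b))

  -- Passing between instances and their raw forms

  raw : ∀ {n} → Tradeoff n → Raw
  raw t = map (map₂ toℕ) (fragments t)

  rawInstance : FMP → List (List Raw)
  rawInstance F = tabulate (map raw ∘ tradeoffs F)

  coef-raw : ∀ {n} (b : Fin n) t → coef (toℕ b) (raw t) ≡ coefficient b t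
  coef-raw b t = go (fragments t)
    where
    go : ∀ fs → coef (toℕ b) (map (map₂ toℕ) fs) ≡ sumℚ (map proj₁ (filter (λ (_ , c) → c ≟ᶠ b) fs))
    go [] = refl
    go ((p , c) ∷ fs) with c ≟ᶠ b
    ... | yes refl = trans
      (cong (sumℚ ∘ map proj₁) (filter-accept (λ (_ , d) → d ℕ.≟ toℕ b) {xs = map (map₂ toℕ) fs} refl))
      (cong (p +_) (go fs))
    ... | no c≢b = trans
      (cong (sumℚ ∘ map proj₁)
        (filter-reject (λ (_ , d) → d ℕ.≟ toℕ b) {x = p , toℕ c} {xs = map (map₂ toℕ) fs} (c≢b ∘ toℕ-injective)))
      (go fs)

  map-proj₁-raw : ∀ {n} (fs : List (Fragment n)) → map proj₁ (map (map₂ toℕ) fs) ≡ map proj₁ fs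
  map-proj₁-raw []       = refl
  map-proj₁-raw (f ∷ fs) = cong (_ ∷_) (map-proj₁-raw fs)

  raw-valid : ∀ {n} (t : Tradeoff n) → Valid n (raw t)
  raw-valid t = valid
    (All.map⁺ (All.universal (λ (_ , c) → toℕ<n c) (fragments t)))
    (All.map⁺ (bounded t))
    (trans (cong sumℚ (map-proj₁-raw (fragments t))) (total t))

  valid⇒nonneg : ∀ {n t} → Valid n t → NonNeg t
  valid⇒nonneg v = All.map proj₁ (weights v)

  rawInstance-All : ∀ {P : Raw → Set} F → (∀ t → P (raw {∣B∣ F} t)) → All (All P) (rawInstance F)
  rawInstance-All F p = All.tabulate⁺ (λ g → All.map⁺ (All.universal p (tradeoffs F g)))

  load-tabulate : ∀ {m n} b (f : Fin m → Tradeoff n) →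
    load (toℕ b) (tabulate (raw ∘ f)) ≡ sum (λ g → coefficient b (f g))
  load-tabulate {zero}  b f = refl
  load-tabulate {suc m} b f = cong₂ _+_ (coef-raw b (f zero)) (load-tabulate b (f ∘ suc))

  solution⇒raw : ∀ F → Solution F → RawSolution (rawInstance F)
  solution⇒raw F s = tabulate (raw ∘ choice) , Pointwise.tabulate⁺ (∈-map⁺ raw ∘ allowed) , bound
    where
    open Solution s
    bound : ∀ b → load b (tabulate (raw ∘ choice)) ≤ 1ℚ
    bound b with b ℕ.<? ∣B∣ F
    ... | yes b<B = subst (_≤ 1ℚ)
      (trans (sym (load-tabulate (fromℕ< b<B) choice))
             (cong (λ c → load c (tabulate (raw ∘ choice))) (toℕ-fromℕ< b<B)))
      (feasible (fromℕ< b<B))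
    -- Raw solutions also bound numbers that are no elements of `F`; these carry load 0.
    ... | no b≮B = subst (_≤ 1ℚ)
      (sym (load-outside (All.tabulate⁺ (raw-valid ∘ choice)) (ℕ.≮⇒≥ b≮B))) 0≤1

  raw-choice : ∀ {m n} (f : Fin m → List (Tradeoff n)) {us} → Pointwise _∈_ us (tabulate (map raw ∘ f)) →
    Σ[ c ∈ (Fin m → Tradeoff n) ] (∀ g → c g ∈ f g) × us ≡ tabulate (raw ∘ c)
  raw-choice {zero}  f []      = (λ ()) , (λ ()) , refl
  raw-choice {suc m} f (p ∷ q) with t , t∈ , refl ← ∈-map⁻ raw p | c , c∈ , refl ← raw-choice (f ∘ suc) q
    = (λ { zero → t ; (suc g) → c g }) , (λ { zero → t∈ ; (suc g) → c∈ g }) , refl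

  raw⇒solution : ∀ F → RawSolution (rawInstance F) → Solution F
  raw⇒solution F (us , p , ≤1) with c , c∈ , refl ← raw-choice (tradeoffs F) p = record
    { choice   = c
    ; allowed  = c∈
    ; feasible = λ b → subst (_≤ 1ℚ) (load-tabulate b c) (≤1 (toℕ b))
    }

  -- Realising the gadgets as an FMP instance

  -- In a valve, `t` only uses elements below `a`; this keeps it distinct from the integral tradeoff
  -- on `a`, even when `t` is itself integral.
  data Gadget (N : ℕ) : List Raw → Set where
    peg    : ∀ {a} → a ℕ.< N → Gadget N [ single a ]
    switch : ∀ {a} → 2 ℕ.+ a ℕ.< N → Gadget N (single a ∷ single (1 ℕ.+ a) ∷ single (2 ℕ.+ a) ∷ [])
    valve  : ∀ {a t} → a ℕ.< N → Valid a t → Gadget N (single a ∷ t ∷ [])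

  valid-mono : ∀ {m n t} → m ℕ.≤ n → Valid m t → Valid n t
  valid-mono m≤n (valid r w s) = valid (All.map (λ p → ℕ.<-≤-trans p m≤n) r) w s

  chainEnd-≥ : ∀ n ts → n ℕ.≤ chainEnd n ts
  chainEnd-≥ n []       = ℕ.≤-refl
  chainEnd-≥ n (_ ∷ ts) = ℕ.≤-trans (ℕ.m≤n+m n 2) (chainEnd-≥ (2 ℕ.+ n) ts)

  gadgetsEnd-≥ : ∀ n G → n ℕ.≤ gadgetsEnd n G
  gadgetsEnd-≥ n []       = ℕ.≤-refl
  gadgetsEnd-≥ n (ts ∷ G) =
    ℕ.≤-trans (ℕ.≤-trans (chainEnd-≥ n ts) (ℕ.n≤1+n _)) (gadgetsEnd-≥ _ G)

  chain-gadgets : ∀ {N} n ts {S} → All (Valid n) ts → chainEnd n ts ℕ.< N →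
    All (Gadget N) S → All (Gadget N) (chain n ts S)
  chain-gadgets n []       []       e<N p = p
  chain-gadgets n (t ∷ ts) (v ∷ vs) e<N p =
    chain-gadgets (2 ℕ.+ n) ts (All.map (valid-mono (ℕ.m≤n+m n 2)) vs) e<N
      (valve (ℕ.<⇒≤ 2+n<N) (valid-mono (ℕ.n≤1+n n) v) ∷ switch 2+n<N ∷ p)
    where 2+n<N = ℕ.≤-<-trans (chainEnd-≥ (2 ℕ.+ n) ts) e<N

  gadgets-gadgets : ∀ {N} n G {S} → All (All (Valid n)) G → gadgetsEnd n G ℕ.≤ N →
    All (Gadget N) S → All (Gadget N) (gadgets n G S)
  gadgets-gadgets n []       []       e≤N p = p
  gadgets-gadgets n (ts ∷ G) (v ∷ vs) e≤N p =
    gadgets-gadgets (suc e) G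
      (All.map (All.map (valid-mono (ℕ.≤-trans (chainEnd-≥ n ts) (ℕ.n≤1+n e)))) vs) e≤N
      (peg e<N ∷ chain-gadgets n ts v e<N (peg (ℕ.≤-<-trans (chainEnd-≥ n ts) e<N) ∷ p))
    where
    e = chainEnd n ts
    e<N = ℕ.≤-trans (gadgetsEnd-≥ (suc e) G) e≤N

  integral : ∀ {N} → Fin N → Tradeoff N
  integral b = record
    { fragments = [ (1ℚ , b) ]
    ; bounded   = (0≤1 , ≤-refl) ∷ []
    ; total     = refl
    }

  place : ∀ {N t} → InRange N t → List (Fragment N)
  place []                   = []
  place (_∷_ {p , _} c<N cs) = (p , fromℕ< c<N) ∷ place cs

  raw-place : ∀ {N t} (r : InRange N t) → map (map₂ toℕ) (place r) ≡ t
  raw-place []         = refl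
  raw-place (c<N ∷ cs) = cong₂ _∷_ (cong (_ ,_) (toℕ-fromℕ< c<N)) (raw-place cs)

  fromRaw : ∀ {N t} → Valid N t → Tradeoff N
  fromRaw {N} {t} (valid r w s) = record
    { fragments = place r
    ; bounded   = All.map⁻ (subst (All _) (sym (raw-place r)) w)
    ; total     = trans (trans (cong sumℚ (sym (map-proj₁-raw (place r))))
                               (cong (sumℚ ∘ map proj₁) (raw-place r))) s
    }

  realise : ∀ {N T} → Gadget N T → List (Tradeoff N)
  realise (peg a<N)      = [ integral (fromℕ< a<N) ]
  realise (switch 2+a<N) =
    integral (fromℕ< (ℕ.<⇒≤ (ℕ.<⇒≤ 2+a<N))) ∷ integral (fromℕ< (ℕ.<⇒≤ 2+a<N)) ∷ integral (fromℕ< 2+a<N) ∷ []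
  realise (valve a<N v)  = integral (fromℕ< a<N) ∷ fromRaw (valid-mono (ℕ.<⇒≤ a<N) v) ∷ []

  raw-integral : ∀ {N a} (a<N : a ℕ.< N) → raw (integral (fromℕ< a<N)) ≡ single a
  raw-integral a<N = cong single (toℕ-fromℕ< a<N)

  raw-realise : ∀ {N T} (g : Gadget N T) → map raw (realise g) ≡ T
  raw-realise (peg a<N) = cong (_∷ []) (raw-integral a<N)
  raw-realise (switch 2+a<N) = cong₂ _∷_ (raw-integral (ℕ.<⇒≤ (ℕ.<⇒≤ 2+a<N)))
    (cong₂ _∷_ (raw-integral (ℕ.<⇒≤ 2+a<N)) (cong (_∷ []) (raw-integral 2+a<N)))
  raw-realise (valve a<N v) = cong₂ _∷_ (raw-integral a<N)
    (cong (_∷ []) (raw-place (inRange (valid-mono (ℕ.<⇒≤ a<N) v))))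

  -- A permutation of a singleton is that singleton, so comparing with an integral tradeoff up to
  -- order reduces to equality of raw forms.
  integral-≈ : ∀ {N a} (a<N : a ℕ.< N) t → integral (fromℕ< a<N) ≈ t → raw t ≡ single a
  integral-≈ a<N t p = trans (↭-singleton-inv (↭-sym (↭.map⁺ (map₂ toℕ) p))) (raw-integral a<N)

  single-injective : ∀ {a b} → single a ≡ single b → a ≡ b
  single-injective refl = refl

  single-invalid : ∀ {a} → ¬ Valid a (single a)
  single-invalid (valid (a<a ∷ []) _ _) = ℕ.<-irrefl refl a<a

  realise-distinct : ∀ {N T} (g : Gadget N T) → AllPairs (λ t u → ¬ (t ≈ u)) (realise g)
  realise-distinct (peg a<N) = [] ∷ []
  realise-distinct {N} (switch {a} 2+a<N) =
    (≉ p q (ℕ.<⇒≢ (ℕ.n<1+n a)) ∷ ≉ p 2+a<N (ℕ.<⇒≢ (ℕ.m≤n+m (suc a) 1)) ∷ [])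
    ∷ (≉ q 2+a<N (ℕ.<⇒≢ (ℕ.n<1+n (suc a))) ∷ []) ∷ [] ∷ []
    where
    q = ℕ.<⇒≤ 2+a<N
    p = ℕ.<⇒≤ q
    ≉ : ∀ {a b} (p : a ℕ.< N) (q : b ℕ.< N) → a ≢ b → ¬ (integral (fromℕ< p) ≈ integral (fromℕ< q))
    ≉ p q a≢b e = a≢b (sym (single-injective (trans (sym (raw-integral q)) (integral-≈ p (integral (fromℕ< q)) e))))
  realise-distinct (valve {a} {t} a<N v) = (≉ ∷ []) ∷ [] ∷ []
    where
    w = valid-mono (ℕ.<⇒≤ a<N) v
    ≉ : ¬ (integral (fromℕ< a<N) ≈ fromRaw w)
    ≉ e = single-invalid (subst (Valid a)
      (trans (sym (raw-place (inRange w))) (integral-≈ a<N (fromRaw w) e)) v)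

  realise-≤3 : ∀ {N T} (g : Gadget N T) → length (realise g) ℕ.≤ 3
  realise-≤3 (peg _)     = s≤s z≤n
  realise-≤3 (switch _)  = s≤s (s≤s (s≤s z≤n))
  realise-≤3 (valve _ _) = s≤s (s≤s z≤n)

  -- Only the second entry of a valve can be fractional, and a valve has two entries.
  realise-fractional : ∀ {N T} (g : Gadget N T) {t} → t ∈ realise g → Fractional t →
    length (realise g) ≡ 2 × (∀ {u} → u ∈ realise g → Fractional u → t ≈ u)
  realise-fractional (peg _)     (here refl)                 f = contradiction (_ , refl) f
  realise-fractional (switch _)  (here refl)                 f = contradiction (_ , refl) f
  realise-fractional (switch _)  (there (here refl))         f = contradiction (_ , refl) f
  realise-fractional (switch _)  (there (there (here refl))) f = contradiction (_ , refl) f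
  realise-fractional (valve _ _) (here refl)                 f = contradiction (_ , refl) f
  realise-fractional (valve _ _) (there (here refl))         f = refl , λ where
    (here refl)         f′ → contradiction (_ , refl) f′
    (there (here refl)) _  → ↭-refl

  module _ {N} {S : List (List Raw)} (gs : All (Gadget N) S) where

    gadgetAt : ∀ i → Gadget N (lookup S i)
    gadgetAt i = All.lookup gs (∈-lookup i)

    assemble : FMP
    assemble = record
      { ∣G∣       = length S
      ; ∣B∣       = N
      ; tradeoffs = realise ∘ gadgetAt
      ; distinct  = realise-distinct ∘ gadgetAt
      }

    raw-assemble : rawInstance assemble ≡ S
    raw-assemble = trans (tabulate-cong (raw-realise ∘ gadgetAt)) (tabulate-lookup S)

  -- The reduction and its properties

  module _ (F : FMP) where

    reducedSize : ℕ
    reducedSize = gadgetsEnd (∣B∣ F) (rawInstance F)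

    reduce-gadgets : All (Gadget reducedSize) (gadgets (∣B∣ F) (rawInstance F) [])
    reduce-gadgets = gadgets-gadgets (∣B∣ F) (rawInstance F) (rawInstance-All F raw-valid) ℕ.≤-refl []

    reduce : FMP
    reduce = assemble reduce-gadgets

    -- Solvability and encoding can both be read off the raw form, so this equation transfers the
    -- correctness proof as well as the analysis of the program.
    raw-reduce : rawInstance reduce ≡ gadgets (∣B∣ F) (rawInstance F) []
    raw-reduce = raw-assemble reduce-gadgets

    reduce-⇔ : Solution F ⇔ Solution reduce
    reduce-⇔ = mk⇔
      (λ s → raw⇒solution reduce (subst RawSolution (sym raw-reduce)
        (gadgets-complete (∣B∣ F) (rawInstance F) (rawInstance-All F raw-valid) (solution⇒raw F s))))
      (λ s → raw⇒solution F (gadgets-sound (∣B∣ F) (rawInstance F)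
        -- The gadgets inherit nonnegative weights from the tradeoffs that realise them.
        (subst (All (All NonNeg)) raw-reduce (rawInstance-All reduce (valid⇒nonneg ∘ raw-valid)))
        (subst RawSolution raw-reduce (solution⇒raw reduce s))))

    reduce-≤3 : AtMostThreeTradeoffs reduce
    reduce-≤3 g = realise-≤3 (gadgetAt reduce-gadgets g)

    reduce-≤1 : AtMostOneFractional reduce
    reduce-≤1 g t∈ u∈ ft fu = proj₂ (realise-fractional (gadgetAt reduce-gadgets g) t∈ ft) u∈ fu

    reduce-pairs : FractionalInPairs reduce
    reduce-pairs g t∈ ft = proj₁ (realise-fractional (gadgetAt reduce-gadgets g) t∈ ft)

open Correctness

module Complexity where

  open import Data.Nat.Base using (_+_; _*_; _^_; _≤_)
  open import Data.Nat.Properties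
    using (+-mono-≤; +-monoʳ-≤; +-monoˡ-≤; +-suc; *-distribʳ-+; *-identityˡ; *-monoʳ-≤; *-monoˡ-≤; *-suc;
           m≤m+n; m≤n+m; m≤m*n; m≤n⇒m≤1+n; n≤1+n; ≤-refl; ≤-reflexive; ≤-trans; module ≤-Reasoning)

  -- Encoding raw instances

  encodeRaw : Raw → Tree
  encodeRaw = encodeList (λ (p , c) → encodeℚ p ∙ encodeUnary c)

  encodeSets : List (List Raw) → Tree
  encodeSets = encodeList (encodeList encodeRaw)

  encodeList-map : ∀ {A B : Set} {enc : A → Tree} {enc′ : B → Tree} (f : A → B) →
    (∀ a → enc a ≡ enc′ (f a)) → ∀ xs → encodeList enc xs ≡ encodeList enc′ (map f xs)
  encodeList-map f h []       = refl
  encodeList-map f h (x ∷ xs) = cong₂ _∙_ (h x) (encodeList-map f h xs)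

  encodeFMP-raw : ∀ F → encodeFMP F ≡ encodeUnary (∣B∣ F) ∙ encodeSets (rawInstance F)
  encodeFMP-raw F = cong (encodeUnary (∣B∣ F) ∙_)
    (trans (encodeList-map (map raw) (encodeList-map raw (encodeList-map (map₂ toℕ) (λ _ → refl) ∘ fragments))
             (tabulate (tradeoffs F)))
           (cong encodeSets (map-tabulate (tradeoffs F) (map raw))))

  -- Cost of expressions and commands

  size>0 : ∀ t → 1 ≤ size t
  size>0 nil     = s≤s z≤n
  size>0 (_ ∙ _) = s≤s z≤n

  size-left : ∀ t → size (left t) ≤ size t
  size-left nil     = ≤-refl
  size-left (l ∙ r) = m≤n⇒m≤1+n (m≤m+n (size l) (size r))

  size-right : ∀ t → size (right t) ≤ size t
  size-right nil     = ≤-refl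
  size-right (l ∙ r) = m≤n⇒m≤1+n (m≤n+m (size r) (size l))

  size-eval≤cost : ∀ {k} (e : Expr k) σ → size (eval e σ) ≤ cost e σ
  size-eval≤cost (reg x) σ = ≤-refl
  size-eval≤cost nil     σ = ≤-refl
  size-eval≤cost (e ∙ f) σ = s≤s (+-mono-≤ (size-eval≤cost e σ) (size-eval≤cost f σ))
  size-eval≤cost (hd e)  σ = m≤n⇒m≤1+n (≤-trans (size-left (eval e σ)) (size-eval≤cost e σ))
  size-eval≤cost (tl e)  σ = m≤n⇒m≤1+n (≤-trans (size-right (eval e σ)) (size-eval≤cost e σ))

  nodes : ∀ {k} → Expr k → ℕ
  nodes (reg x) = 1
  nodes nil     = 1
  nodes (e ∙ f) = suc (nodes e + nodes f)
  nodes (hd e)  = suc (nodes e)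
  nodes (tl e)  = suc (nodes e)

  AllSmall : ∀ {k} → ℕ → Store k → Set
  AllSmall Y = VecAll.All (λ t → size t ≤ Y)

  cost≤ : ∀ {k Y} (e : Expr k) {σ} → 1 ≤ Y → AllSmall Y σ → cost e σ ≤ nodes e * Y
  cost≤ {Y = Y} (reg x) 1≤Y s = ≤-trans (VecAll.lookup⁺ s x) (≤-reflexive (sym (*-identityˡ Y)))
  cost≤ {Y = Y} nil     1≤Y s = ≤-trans 1≤Y (≤-reflexive (sym (*-identityˡ Y)))
  cost≤ {Y = Y} (e ∙ f) 1≤Y s = +-mono-≤ 1≤Y (≤-trans (+-mono-≤ (cost≤ e 1≤Y s) (cost≤ f 1≤Y s))
    (≤-reflexive (sym (*-distribʳ-+ Y (nodes e) (nodes f)))))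
  cost≤         (hd e)  1≤Y s = +-mono-≤ 1≤Y (cost≤ e 1≤Y s)
  cost≤         (tl e)  1≤Y s = +-mono-≤ 1≤Y (cost≤ e 1≤Y s)

  -- The additional unit pays for the node that joins the value to the output list.
  eval-size≤ : ∀ {k Y} (e : Expr k) {σ} → 1 ≤ Y → AllSmall Y σ → suc (size (eval e σ)) ≤ suc (nodes e) * Y
  eval-size≤ e 1≤Y s = +-mono-≤ 1≤Y (≤-trans (size-eval≤cost e _) (cost≤ e 1≤Y s))

  module Running (Y : ℕ) (1≤Y : 1 ≤ Y) where

    -- Time is measured in units of `Y`, a common bound on all register sizes, so that costs become
    -- syntactic counts that add up.
    record Runs {k} (c : Command k) (σ : Store k) (m : ℕ) (τ : Store k) : Set where
      constructor runs
      field
        {time} : ℕ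
        run    : c , σ ⇓[ time ] τ
        bound  : time ≤ m * Y

    runs-assign : ∀ {k} {x : Fin k} e {σ} → AllSmall Y σ → Runs (x ≔ e) σ (suc (nodes e)) (σ [ x ]≔ eval e σ)
    runs-assign e s = runs assign (+-mono-≤ 1≤Y (cost≤ e 1≤Y s))

    infixr 5 _∣_
    _∣_ : ∀ {k} {c d : Command k} {σ τ υ m n} → Runs c σ m τ → Runs d τ n υ → Runs (c ⨾ d) σ (m + n) υ
    _∣_ {m = m} {n} (runs r p) (runs s q) =
      runs (seq r s) (≤-trans (+-mono-≤ p q) (≤-reflexive (sym (*-distribʳ-+ Y m n))))

    runs-stop : ∀ {k} (e : Expr k) {c σ} → AllSmall Y σ → eval e σ ≡ nil → Runs while e ⟨ c ⟩ σ (suc (nodes e)) σ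
    runs-stop e s p = runs (stop p) (+-mono-≤ 1≤Y (cost≤ e 1≤Y s))

    runs-loop : ∀ {k} (e : Expr k) {c σ τ υ m n} → AllSmall Y σ → eval e σ ≢ nil →
      Runs c σ m τ → Runs while e ⟨ c ⟩ τ n υ → Runs while e ⟨ c ⟩ σ (suc (nodes e) + m + n) υ
    runs-loop e {m = m} {n} s p (runs r q) (runs r′ q′) = runs (loop p r r′)
      (≤-trans (+-mono-≤ (+-mono-≤ (+-mono-≤ 1≤Y (cost≤ e 1≤Y s)) q) q′)
        (≤-reflexive (trans (cong (_+ n * Y) (sym (*-distribʳ-+ Y (suc (nodes e)) m)))
                            (sym (*-distribʳ-+ Y (suc (nodes e) + m) n)))))

    runs-weaken : ∀ {k} {c : Command k} {σ m n τ} → m ≤ n → Runs c σ m τ → Runs c σ n τ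
    runs-weaken m≤n (runs r p) = runs r (≤-trans p (*-monoˡ-≤ Y m≤n))

  -- The program

  constant : ∀ {k} → Tree → Expr k
  constant nil     = nil
  constant (l ∙ r) = constant l ∙ constant r

  -- Registers: 0F the remaining tradeoff sets, 1F the counter, 2F the output, 3F the remaining tradeoffs of the
  -- current set.

  singleE : Expr 4 → Expr 4
  singleE e = (constant (encodeℚ 1ℚ) ∙ e) ∙ nil

  pegE switchE valveE : Expr 4
  pegE    = singleE (reg 1F) ∙ nil
  switchE = singleE (reg 1F) ∙ singleE (nil ∙ reg 1F) ∙ singleE (nil ∙ nil ∙ reg 1F) ∙ nil
  valveE  = singleE (nil ∙ reg 1F) ∙ hd (reg 3F) ∙ nil

  chainBody groupBody reduceBody : Command 4
  chainBody  = 2F ≔ (valveE ∙ switchE ∙ reg 2F) ⨾ 1F ≔ (nil ∙ nil ∙ reg 1F) ⨾ 3F ≔ tl (reg 3F)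
  groupBody  = 2F ≔ (pegE ∙ reg 2F) ⨾ 3F ≔ hd (reg 0F) ⨾ 0F ≔ tl (reg 0F) ⨾ while reg 3F ⟨ chainBody ⟩ ⨾
               2F ≔ (pegE ∙ reg 2F) ⨾ 1F ≔ (nil ∙ reg 1F)
  reduceBody = 1F ≔ hd (reg 0F) ⨾ 0F ≔ tl (reg 0F) ⨾ while reg 0F ⟨ groupBody ⟩ ⨾ 0F ≔ (reg 1F ∙ reg 2F)

  -- A loop is charged for a single iteration; the number of iterations enters later as a factor.
  weight : Command 4 → ℕ
  weight (_ ≔ e)       = suc (nodes e)
  weight (c ⨾ d)       = weight c + weight d
  weight while e ⟨ c ⟩ = suc (nodes e) + weight c

  chainUnit groupUnit : ℕ
  chainUnit = weight while reg 3F ⟨ chainBody ⟩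
  groupUnit = weight while reg 0F ⟨ groupBody ⟩

  -- Bounds the growth of the output per iteration, in units of the size of the other registers.
  growth : ℕ
  growth = suc (nodes valveE) + (suc (nodes switchE) + suc (nodes pegE))

  -- Running time of the loops

  module Timing (X : ℕ) (1≤X : 1 ≤ X) (Y : ℕ) (X≤Y : X ≤ Y) where

    1≤Y : 1 ≤ Y
    1≤Y = ≤-trans 1≤X X≤Y

    open Running Y 1≤Y

    D : ℕ
    D = growth * X

    -- A potential: each tree node of input still to be read reserves 2 for the counter u and D for the output a.
    record Budget (u a p : ℕ) : Set where
      constructor budget
      field
        counter : u + p * 2 ≤ X
        output  : a + p * D ≤ Y

    open Budget

    relax : ∀ {u u′ a a′ p p′} → u′ ≤ u → a′ ≤ a → p′ ≤ p → Budget u a p → Budget u′ a′ p′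
    relax u≤ a≤ p≤ (budget c o) = budget
      (≤-trans (+-mono-≤ u≤ (*-monoˡ-≤ 2 p≤)) c)
      (≤-trans (+-mono-≤ a≤ (*-monoˡ-≤ D p≤)) o)

    -- One unit of potential pays for one set put onto the output and one increment of the counter,
    -- whose unary digits take two nodes each.
    spend : ∀ {u a p d} → d ≤ D → Budget u a (suc p) → Budget (2 + u) (d + a) p
    spend {u} {a} {p} {d} d≤D (budget c o) = budget
      (≤-trans (≤-reflexive (exchange 2 u (p * 2))) c)
      (≤-trans (≤-trans (≤-reflexive (exchange d a (p * D))) (+-monoʳ-≤ a (+-monoˡ-≤ (p * D) d≤D))) o)
      where
      exchange : ∀ x y z → x + y + z ≡ y + (x + z)
      exchange = solve-∀

    u≤X : ∀ {u a p} → Budget u a p → u ≤ X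
    u≤X b = ≤-trans (m≤m+n _ _) (counter b)

    p≤X : ∀ {u a p} → Budget u a p → p ≤ X
    p≤X {p = p} b = ≤-trans (≤-trans (m≤m*n p 2) (m≤n+m _ _)) (counter b)

    a≤Y : ∀ {u a p} → Budget u a p → a ≤ Y
    a≤Y b = ≤-trans (m≤m+n _ _) (output b)

    small : ∀ {G n S T p} → Budget (size n) (size S) p → size G ≤ p → size T ≤ p →
      AllSmall Y (G ∷ n ∷ S ∷ T ∷ [])
    small b G≤p T≤p = ≤-trans (≤-trans G≤p (p≤X b)) X≤Y ∷ ≤-trans (u≤X b) X≤Y ∷ a≤Y b
      ∷ ≤-trans (≤-trans T≤p (p≤X b)) X≤Y ∷ []

    -- The gadget expressions do not read the output register, so they have the same value with
    -- `nil` there. Their size is thus bounded in terms of `X` instead of `Y`, and the output grows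
    -- only by `D` per set.
    inputSmall : ∀ {G n T} {S : Tree} {p} → Budget (size n) (size S) p → size G ≤ p → size T ≤ p →
      AllSmall X (G ∷ n ∷ nil ∷ T ∷ [])
    inputSmall b G≤p T≤p = ≤-trans G≤p (p≤X b) ∷ u≤X b ∷ 1≤X ∷ ≤-trans T≤p (p≤X b) ∷ []

    valve≤D : suc (nodes valveE) * X ≤ D
    valve≤D = *-monoˡ-≤ X (m≤m+n (suc (nodes valveE)) (suc (nodes switchE) + suc (nodes pegE)))

    switch≤D : suc (nodes switchE) * X ≤ D
    switch≤D = *-monoˡ-≤ X (≤-trans (m≤m+n (suc (nodes switchE)) (suc (nodes pegE))) (m≤n+m _ (suc (nodes valveE))))

    peg≤D : suc (nodes pegE) * X ≤ D
    peg≤D = *-monoˡ-≤ X (≤-trans (m≤n+m (suc (nodes pegE)) (suc (nodes switchE))) (m≤n+m _ (suc (nodes valveE))))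

    chainState : Tree → ℕ → List (List Raw) → List Raw → Store 4
    chainState G n S ts = G ∷ encodeUnary n ∷ encodeSets S ∷ encodeList encodeRaw ts ∷ []

    StateBudget : ℕ → List (List Raw) → ℕ → Set
    StateBudget n S = Budget (size (encodeUnary n)) (size (encodeSets S))

    chain-runs : ∀ n ts S G R → size G ≤ R → StateBudget n S (size (encodeList encodeRaw ts) + R) →
      Runs while reg 3F ⟨ chainBody ⟩ (chainState G n S ts)
        (chainUnit * size (encodeList encodeRaw ts)) (chainState G (chainEnd n ts) (chain n ts S) [])
      × StateBudget (chainEnd n ts) (chain n ts S) (1 + R)
    chain-runs n [] S G R G≤R b =
      runs-weaken (s≤s (s≤s z≤n)) (runs-stop (reg 3F) (small b (m≤n⇒m≤1+n G≤R) (s≤s z≤n)) refl) , b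
    chain-runs n (t ∷ ts) S G R G≤R b =
      runs-weaken time
        (runs-loop (reg 3F) (small b G≤p T≤p) (λ ())
          (runs-assign (valveE ∙ switchE ∙ reg 2F) (small b G≤p T≤p)
          ∣ runs-assign (nil ∙ nil ∙ reg 1F) (G≤Y ∷ n≤Y ∷ a≤Y b′ ∷ T≤Y ∷ [])
          ∣ runs-assign (tl (reg 3F)) (G≤Y ∷ ≤-trans (u≤X b′) X≤Y ∷ a≤Y b′ ∷ T≤Y ∷ []))
          (proj₁ rest))
      , proj₂ rest
      where
      S′ = (single (1 + n) ∷ t ∷ []) ∷ (single n ∷ single (1 + n) ∷ single (2 + n) ∷ []) ∷ S
      T  = encodeList encodeRaw (t ∷ ts)
      T′ = encodeList encodeRaw ts
      G≤p : size G ≤ size T + R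
      G≤p = ≤-trans G≤R (m≤n+m R (size T))
      T≤p : size T ≤ size T + R
      T≤p = m≤m+n (size T) R
      G≤Y : size G ≤ Y
      G≤Y = ≤-trans (≤-trans G≤p (p≤X b)) X≤Y
      T≤Y : size T ≤ Y
      T≤Y = ≤-trans (≤-trans T≤p (p≤X b)) X≤Y
      n≤Y : size (encodeUnary n) ≤ Y
      n≤Y = ≤-trans (u≤X b) X≤Y

      b′ : StateBudget (2 + n) S′ (size T′ + R)
      -- The list cell and the tradeoff `t` in it release at least two units, one for the triple and
      -- one for the pair.
      b′ = spend (≤-trans (eval-size≤ valveE {G ∷ encodeUnary n ∷ nil ∷ T ∷ []} 1≤X (inputSmall b G≤p T≤p)) valve≤D)
          (spend (≤-trans (eval-size≤ switchE {G ∷ encodeUnary n ∷ nil ∷ T ∷ []} 1≤X (inputSmall b G≤p T≤p)) switch≤D)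
          (relax ≤-refl ≤-refl (s≤s (+-monoˡ-≤ R (+-monoˡ-≤ (size T′) (size>0 (encodeRaw t))))) b))

      rest = chain-runs (2 + n) ts S′ G R G≤R b′

      time : chainUnit + chainUnit * size T′ ≤ chainUnit * size T
      time = ≤-trans (≤-reflexive (sym (*-suc chainUnit (size T′))))
        (*-monoʳ-≤ chainUnit (s≤s (m≤n+m (size T′) (size (encodeRaw t)))))

    groups-runs : ∀ n G S → StateBudget n S (1 + size (encodeSets G)) →
      Runs while reg 0F ⟨ groupBody ⟩ (chainState (encodeSets G) n S [])
        (groupUnit * size (encodeSets G)) (chainState nil (gadgetsEnd n G) (gadgets n G S) [])
      × StateBudget (gadgetsEnd n G) (gadgets n G S) 2
    groups-runs n [] S b = runs-weaken (s≤s (s≤s z≤n)) (runs-stop (reg 0F) (small b (s≤s z≤n) (s≤s z≤n)) refl) , b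
    groups-runs n (ts ∷ G) S b =
      runs-weaken (time 2 pegTime (weight (3F ≔ hd (reg 0F))) (weight (0F ≔ tl (reg 0F))) chainUnit
                          (pegTime + weight (1F ≔ (nil ∙ reg 1F))) (size T) (size G′))
        (runs-loop (reg 0F) (small b (n≤1+n _) (s≤s z≤n)) (λ ())
          (runs-assign (pegE ∙ reg 2F) (small b (n≤1+n _) (s≤s z≤n))
          ∣ runs-assign (hd (reg 0F)) (G≤Y ∷ n≤Y ∷ a≤Y b₁ ∷ 1≤Y ∷ [])
          ∣ runs-assign (tl (reg 0F)) (G≤Y ∷ n≤Y ∷ a≤Y b₁ ∷ T≤Y ∷ [])
          ∣ proj₁ inner
          ∣ runs-assign (pegE ∙ reg 2F) (small b₂ G′≤p (s≤s z≤n))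
          ∣ runs-assign (nil ∙ reg 1F)
              (≤-trans (≤-trans G′≤p (p≤X b₂)) X≤Y ∷ ≤-trans (u≤X b₂) X≤Y ∷ a≤Y b₃ ∷ 1≤Y ∷ []))
          (proj₁ rest))
      , proj₂ rest
      where
      T  = encodeList encodeRaw ts
      G′ = encodeSets G
      e  = chainEnd n ts
      pegTime = weight (2F ≔ (pegE ∙ reg 2F))
      S₁ = (single n ∷ []) ∷ S
      S₂ = chain n ts S₁

      G≤Y : size (T ∙ G′) ≤ Y
      G≤Y = ≤-trans (≤-trans (n≤1+n _) (p≤X b)) X≤Y
      T≤Y : size T ≤ Y
      T≤Y = ≤-trans (size-left (T ∙ G′)) G≤Y
      n≤Y : size (encodeUnary n) ≤ Y
      n≤Y = ≤-trans (u≤X b) X≤Y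

      peg-small : ∀ n S {p} (G : Tree) → StateBudget n S (suc p) → size G ≤ suc p →
        suc (size (encodeList encodeRaw (single n ∷ []))) ≤ D
      peg-small n S G b G≤p = ≤-trans
        (eval-size≤ pegE {G ∷ encodeUnary n ∷ nil ∷ nil ∷ []} 1≤X (inputSmall b G≤p (s≤s z≤n))) peg≤D

      b₁ : StateBudget n S₁ (size T + suc (size G′))
      -- The opening peg leaves the counter alone, so the two nodes paid for an increment are given
      -- back.
      b₁ = relax (m≤n+m _ 2) ≤-refl (≤-reflexive (+-suc (size T) (size G′)))
        (spend (peg-small n S (T ∙ G′) b (n≤1+n _)) b)

      inner = chain-runs n ts S₁ G′ (suc (size G′)) (n≤1+n _) b₁

      b₂ : StateBudget e S₂ (2 + size G′)
      b₂ = proj₂ inner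

      G′≤p : size G′ ≤ 2 + size G′
      G′≤p = m≤n+m _ 2

      b₃ : StateBudget (suc e) ((single e ∷ []) ∷ S₂) (1 + size G′)
      b₃ = spend (peg-small e S₂ G′ b₂ G′≤p) b₂

      rest = groups-runs (suc e) G _ b₃

      -- The work on one set, inner loop included, is charged to the nodes of that set and its list
      -- cell. Adding the slack explicitly turns the inequality into a ring identity.
      time : ∀ a b c d u f t g →
        a + (b + (c + (d + (u * t + f)))) + (a + (b + (c + (d + (u + f))))) * g
          ≤ (a + (b + (c + (d + (u + f))))) * suc (t + g)
      time a b c d u f t g = ≤-trans (m≤m+n _ (u + (a + b + c + d + f) * t))
        (≤-reflexive (expand a b c d u f t g))
        where
        expand : ∀ a b c d u f t g →
          a + (b + (c + (d + (u * t + f)))) + (a + (b + (c + (d + (u + f))))) * g + (u + (a + b + c + d + f) * t)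
            ≡ (a + (b + (c + (d + (u + f))))) * suc (t + g)
        expand = solve-∀

  -- The cubic time bound

  reduceProgram : Program
  reduceProgram = record { spare = 3 ; body = reduceBody }

  reduceFactor : ℕ
  reduceFactor = (weight (1F ≔ hd (reg 0F)) + (weight (0F ≔ tl (reg 0F)) +
    (groupUnit + weight (0F ≔ (reg 1F ∙ reg 2F))))) * (2 + growth * 2)

  total≤cubic : ∀ a b u c h g z → 1 ≤ z → g ≤ z →
    (a + (b + (u * g + c))) * (2 * z + z * (h * (2 * z))) ≤ (a + (b + (u + c))) * (2 + h * 2) * z ^ 3
  -- The number of units is linear in `z` and a unit is quadratic. With `z` as `suc m`, the slack
  -- terms can be written without subtraction.
  total≤cubic a b u c h g z@(suc m) _ g≤z = begin
    (a + (b + (u * g + c))) * Y               ≤⟨ *-monoˡ-≤ Y (+-monoʳ-≤ a (+-monoʳ-≤ b (+-monoˡ-≤ c (*-monoʳ-≤ u g≤z)))) ⟩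
    (a + (b + (u * z + c))) * Y               ≤⟨ *-monoˡ-≤ Y (m≤m+n (a + (b + (u * z + c))) ((a + b + c) * m)) ⟩
    (a + (b + (u * z + c)) + (a + b + c) * m) * Y ≡⟨ cong (_* Y) (linear a b u c m) ⟩
    w * z * Y                                 ≤⟨ m≤m+n _ (w * 2 * z * z * m) ⟩
    w * z * Y + w * 2 * z * z * m             ≡⟨ cubic w h m ⟩
    w * (2 + h * 2) * z ^ 3                   ∎
    where
    open ≤-Reasoning
    w = a + (b + (u + c))
    Y = 2 * z + z * (h * (2 * z))

    linear : ∀ a b u c m → a + (b + (u * suc m + c)) + (a + b + c) * m ≡ (a + (b + (u + c))) * suc m
    linear = solve-∀

    cubic : ∀ w h m → w * suc m * (2 * suc m + suc m * (h * (2 * suc m))) + w * 2 * suc m * suc m * m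
      ≡ w * (2 + h * 2) * (suc m * (suc m * (suc m * 1)))
    cubic = solve-∀

  -- The bound z on the input size is kept a variable so that products with it do not unfold.
  reduceProgram-computes : ∀ n G z → size (encodeUnary n ∙ encodeSets G) ≤ z →
    reduceProgram computes encodeUnary n ∙ encodeSets G
      ↦ encodeUnary (gadgetsEnd n G) ∙ encodeSets (gadgets n G [])
      within reduceFactor * z ^ 3
  reduceProgram-computes n G z I≤z =
    Runs.time result , _ , Runs.run result , refl , ≤-trans (Runs.bound result)
      (total≤cubic (weight (1F ≔ hd (reg 0F))) (weight (0F ≔ tl (reg 0F))) groupUnit
        (weight (0F ≔ (reg 1F ∙ reg 2F))) growth g z 1≤z g≤z)
    where
    I = encodeUnary n ∙ encodeSets G
    s = size (encodeUnary n)
    g = size (encodeSets G)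

    1≤z : 1 ≤ z
    1≤z = ≤-trans (s≤s z≤n) I≤z

    g≤z : g ≤ z
    g≤z = ≤-trans (size-right I) I≤z

    z≤2z : z ≤ 2 * z
    z≤2z = m≤m+n z _

    -- The counter and twice the initial potential fit into `2 * z`. The potential is at most `z`,
    -- and each unit reserves `growth * (2 * z)` of output; the leading `2 * z` covers the initial
    -- `nil` and keeps `X` below `Y`.
    open Timing (2 * z) (≤-trans 1≤z z≤2z) (2 * z + z * (growth * (2 * z))) (m≤m+n (2 * z) _)
    open Running (2 * z + z * (growth * (2 * z))) 1≤Y

    I≤Y : size I ≤ 2 * z + z * (growth * (2 * z))
    I≤Y = ≤-trans I≤z (≤-trans z≤2z (m≤m+n (2 * z) _))

    start : StateBudget n [] (1 + g)
    start = budget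
      (≤-trans (m≤m+n _ s) (≤-trans (≤-reflexive (counter s g)) (*-monoʳ-≤ 2 I≤z)))
      (+-mono-≤ (≤-trans 1≤z z≤2z) (*-monoˡ-≤ D (≤-trans (s≤s (m≤n+m g s)) I≤z)))
      where
      counter : ∀ s g → s + suc g * 2 + s ≡ 2 * suc (s + g)
      counter = solve-∀

    groups = groups-runs n G [] start

    result : Runs reduceBody (I ∷ nil ∷ nil ∷ nil ∷ [])
      (weight (1F ≔ hd (reg 0F)) + (weight (0F ≔ tl (reg 0F)) +
        (groupUnit * g + weight (0F ≔ (reg 1F ∙ reg 2F)))))
      _
    result =
      runs-assign (hd (reg 0F)) (I≤Y ∷ 1≤Y ∷ 1≤Y ∷ 1≤Y ∷ [])
      ∣ runs-assign (tl (reg 0F)) (I≤Y ∷ ≤-trans (size-left I) I≤Y ∷ 1≤Y ∷ 1≤Y ∷ [])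
      ∣ proj₁ groups
      ∣ runs-assign (reg 1F ∙ reg 2F) (small (proj₂ groups) (s≤s z≤n) (s≤s z≤n))

  reduce-polytime : PolyTime encodeFMP encodeFMP reduce
  reduce-polytime = reduceProgram , reduceFactor , 3 , λ F →
    subst₂ (λ x y → reduceProgram computes x ↦ y within reduceFactor * size x ^ 3)
      (sym (encodeFMP-raw F))
      (sym (trans (encodeFMP-raw (reduce F)) (cong (λ S → encodeUnary (∣B∣ (reduce F)) ∙ encodeSets S) (raw-reduce F))))
      (reduceProgram-computes (∣B∣ F) (rawInstance F) _ ≤-refl)

open Complexity

theorem3 : Σ[ reduce ∈ (FMP → FMP) ]
    ((F : FMP) →
    (Solution F ⇔ Solution (reduce F))
    × AtMostThreeTradeoffs (reduce F)
    × AtMostOneFractional (reduce F)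
    × FractionalInPairs (reduce F))
    × PolyTime encodeFMP encodeFMP reduce
theorem3 = reduce , (λ F → reduce-⇔ F , reduce-≤3 F , reduce-≤1 F , reduce-pairs F) , reduce-polytime
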